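{- Let $(c(n))_{n\ge 0}=(C_0,-C_1,-C_1,C_2,C_2,-C_3,-C_3,\dots)=(1,-1,-1,2,2,-5,-5,14,14,\dots)$, i.e. $c(0)=1$ and $c(2m-1)=c(2m)=(-1)^m C_m$ for $m\ge 1$, where $C_m$ are the Catalan numbers. Then for all integers $n\ge 0$ $$\det\bigl(c(i+j)\bigr)_{i,j=0}^{n-1}=(-1)^{\binom n2}F_{n+1}$$ and $$\det\bigl(c(i+j+1)\bigr)_{i,j=0}^{n-1}=(-1)^{\binom{n+1}2}F_{2\lfloor (n+2)/2\rfloor}.$$
   Context: $C_n=\frac{1}{n+1}\binom{2n}{n}$ is the $n$-th Catalan number. $F_n$ is the Fibonacci sequence $F_0=0$, $F_1=1$, $F_n=F_{n-1}+F_{n-2}$. The determinant of the empty ($0\times 0$) matrix is $1$. -}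

module Defs where

open import Data.Fin.Base using (Fin; zero; suc; toℕ; punchIn)
open import Data.Integer.Base as ℤ using (ℤ; +_; 1ℤ; -1ℤ)
open import Data.Integer.Properties using (+-*-semiring)
open import Data.Nat.Base as ℕ using (ℕ; zero; suc; ⌈_/2⌉)
open import Data.Nat.Combinatorics using (_C_)
open import Algebra.Properties.Semiring.Sum +-*-semiring using (sum)

-- The division is exact: n + 1 divides the central binomial coefficient.
catalan : ℕ → ℕ
catalan n = ((2 ℕ.* n) C n) ℕ./ suc n

fib : ℕ → ℕ
fib 0 = 0
fib 1 = 1
fib (suc (suc n)) = fib (suc n) ℕ.+ fib n

-- ⌈ n /2⌉ = m exactly when n = 2m - 1 or n = 2m, so this is
-- c(2m-1) = c(2m) = (-1)^m C_m for m ≥ 1.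
c : ℕ → ℤ
c zero      = 1ℤ
c n@(suc _) = -1ℤ ℤ.^ ⌈ n /2⌉ ℤ.* + catalan ⌈ n /2⌉

SquareMatrix : ℕ → Set
SquareMatrix n = Fin n → Fin n → ℤ

-- Laplace expansion along the first row; punchIn j skips column j.
det : ∀ {n} → SquareMatrix n → ℤ
det {zero}  A = 1ℤ
det {suc n} A = sum λ j →
  -1ℤ ℤ.^ toℕ j ℤ.* A zero j ℤ.* det (λ i k → A (suc i) (punchIn j k))

{-# OPTIONS --safe #-}
module Submission where

-- Let L be the linear functional with L(x^(2m)) = (-1)^m C_m and
-- L(x^(2m+1)) = 0. Its monic orthogonal polynomials are the Fibonacci
-- polynomials p_(k+2) = x p_(k+1) + p_k, with L(p_k²) = (-1)^k, and
-- c(n) = L((1 + x) x^n), c(n+1) = L(x (1 + x) x^n). The polynomials orthogonal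
-- for the weights 1 + x and x (1 + x) come from Christoffel's formula: their
-- product with the weight is a combination of p_n, p_(n+1) (and p_(n+2)) that
-- vanishes at -1 (and 0). Scaled to integer coefficients, with leading
-- coefficient a, such a polynomial makes the last column of the Hankel matrix
-- of order n + 1 vanish except in the corner entry h, so that
-- a Δ_(n+1) = h Δ_n. Since p_n(-1) = (-1)^n F_(n+1), these factors are
-- Fibonacci numbers and the product telescopes.

open import Defs
open import Data.Fin.Base using (Fin; zero; suc; toℕ; punchIn)
open import Data.Integer.Base using (ℤ; +_; 0ℤ; 1ℤ; -1ℤ; _+_; _-_; -_; _*_; _^_; _⊖_)
open import Data.Integer.Properties as ℤ using (+-*-semiring)
open import Data.Integer.Tactic.RingSolver using (solve-∀)
open import Data.List.Base using (List; []; _∷_; _++_; _ʳ++_; [_]; _∷ʳ_; tabulate; applyUpTo)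
open import Data.List.Properties using (++-assoc; applyUpTo-∷ʳ)
open import Data.List.Membership.Propositional.Properties using (∈-applyUpTo⁺; ∈-∃++)
open import Data.Nat.Base as ℕ using (ℕ; zero; suc; ⌊_/2⌋; ⌈_/2⌉)
open import Data.Nat.Combinatorics using (_C_; nC1≡n; nCk≡nC[n∸k]; nCk+nC[k+1]≡[n+1]C[k+1])
import Data.Nat.DivMod as ℕ
import Data.Nat.Properties as ℕ
import Data.Nat.Tactic.RingSolver as ℕ-Ring
open import Data.Product.Base using (_×_; _,_)
open import Relation.Binary.PropositionalEquality hiding ([_])
open import Algebra.Properties.Semiring.Sum +-*-semiring using (sum; sum-cong-≗; *-distribˡ-sum)

open ≡-Reasoning

-- Determinants as functions of a list of columns

Column : Set
Column = ℕ → ℤ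

-- Only rows r, …, r + n - 1 of the columns count, and expand keeps the columns
-- already passed in reverse order. With a list of length other than n the
-- value is a junk one, chosen so that no length hypotheses are needed below.
colDet : (r n : ℕ) → List Column → ℤ
expand : (r n : ℕ) → List Column → List Column → ℤ

colDet r zero    []      = 1ℤ
colDet r zero    (_ ∷ _) = 0ℤ
colDet r (suc n) us      = expand r n [] us

expand r n ps []       = 0ℤ
expand r n ps (u ∷ us) = u r * colDet (suc r) n (ps ʳ++ us) - expand r n (u ∷ ps) us

ʳ++-assoc : ∀ {A : Set} (xs {ys zs} : List A) → (xs ʳ++ ys) ++ zs ≡ xs ʳ++ (ys ++ zs)
ʳ++-assoc []       = refl
ʳ++-assoc (x ∷ xs) = ʳ++-assoc xs

-- The nested subtractions in `expand` produce the alternating signs, counted from the first column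
-- after `ps`.
expand-tabulate : ∀ r n ps {m} (f : Fin (suc m) → Column) →
  expand r n ps (tabulate f)
    ≡ sum λ j → -1ℤ ^ toℕ j * f j r * colDet (suc r) n (ps ʳ++ tabulate (λ k → f (punchIn j k)))
expand-tabulate r n ps {zero} f =
  regroup (f zero r) (colDet (suc r) n (ps ʳ++ []))
  where
  regroup : ∀ x d → x * d - 0ℤ ≡ 1ℤ * x * d + 0ℤ
  regroup = solve-∀
expand-tabulate r n ps {suc m} f = begin
  x * d - expand r n (f zero ∷ ps) (tabulate g)
    ≡⟨ cong (λ t → x * d - t) (expand-tabulate r n (f zero ∷ ps) g) ⟩
  x * d - sum term
    ≡⟨ regroup x d (sum term) ⟩
  1ℤ * x * d + -1ℤ * sum term
    ≡⟨ cong (λ t → 1ℤ * x * d + t) (trans (*-distribˡ-sum -1ℤ term) (sum-cong-≗ λ j →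
         reassoc (-1ℤ ^ toℕ j) (g j r) (colDet (suc r) n (ps ʳ++ (f zero ∷ tabulate (λ k → g (punchIn j k))))))) ⟩
  (sum λ j → -1ℤ ^ toℕ j * f j r * colDet (suc r) n (ps ʳ++ tabulate (λ k → f (punchIn j k)))) ∎
  where
  g = λ j → f (suc j)
  x = f zero r
  d = colDet (suc r) n (ps ʳ++ tabulate g)
  term = λ j → -1ℤ ^ toℕ j * g j r * colDet (suc r) n (ps ʳ++ (f zero ∷ tabulate (λ k → g (punchIn j k))))
  regroup : ∀ x d s → x * d - s ≡ 1ℤ * x * d + -1ℤ * s
  regroup = solve-∀
  reassoc : ∀ s x d → -1ℤ * (s * x * d) ≡ -1ℤ * s * x * d
  reassoc = solve-∀

-- Deleting the first row becomes raising the offset `r`, so the columns themselves stay fixed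
-- during the induction.
det≡colDet : ∀ r {n} (A : SquareMatrix n) (f : Fin n → Column) →
  (∀ i j → A i j ≡ f j (toℕ i ℕ.+ r)) → det A ≡ colDet r n (tabulate f)
det≡colDet r {zero}  A f A≡f = refl
det≡colDet r {suc n} A f A≡f = trans
  (sum-cong-≗ λ j → cong₂ (λ x d → -1ℤ ^ toℕ j * x * d) (A≡f zero j)
    (det≡colDet (suc r) _ (λ k → f (punchIn j k)) λ i k →
      trans (A≡f (suc i) (punchIn j k)) (cong (f (punchIn j k)) (sym (ℕ.+-suc (toℕ i) r)))))
  (sym (expand-tabulate r n [] f))

-- For a transposed pair that has already been passed: every later minor contains both columns and
-- changes sign.
expand-neg : ∀ r n ps qs us →
  (∀ vs → colDet (suc r) n (ps ʳ++ vs) ≡ - colDet (suc r) n (qs ʳ++ vs)) →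
  expand r n ps us ≡ - expand r n qs us
expand-neg r n ps qs []       neg = refl
expand-neg r n ps qs (u ∷ us) neg = begin
  u r * colDet (suc r) n (ps ʳ++ us) - expand r n (u ∷ ps) us
    ≡⟨ cong₂ (λ x y → u r * x - y) (neg us)
         (expand-neg r n (u ∷ ps) (u ∷ qs) us (λ vs → neg (u ∷ vs))) ⟩
  u r * - colDet (suc r) n (qs ʳ++ us) - - expand r n (u ∷ qs) us
    ≡⟨ pull (u r) (colDet (suc r) n (qs ʳ++ us)) _ ⟩
  - expand r n qs (u ∷ us) ∎
  where
  pull : ∀ x d e → x * - d - - e ≡ - (x * d - e)
  pull = solve-∀

-- Induction on the number of rows: minors that keep both columns change sign, and the two minors
-- that drop one of them trade places with opposite signs.
colDet-swap : ∀ r n us {v w} vs →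
  colDet r n (us ++ v ∷ w ∷ vs) ≡ - colDet r n (us ++ w ∷ v ∷ vs)
expand-swap : ∀ r n ps us {v w} vs →
  expand r n ps (us ++ v ∷ w ∷ vs) ≡ - expand r n ps (us ++ w ∷ v ∷ vs)

colDet-swap r zero    []       vs = refl
colDet-swap r zero    (_ ∷ us) vs = refl
colDet-swap r (suc n) us       vs = expand-swap r n [] us vs

expand-swap r n ps [] {v} {w} vs = begin
  v r * dw - (w r * dv - expand r n (w ∷ v ∷ ps) vs)
    ≡⟨ cong (λ e → v r * dw - (w r * dv - e))
         (expand-neg r n (w ∷ v ∷ ps) (v ∷ w ∷ ps) vs swapped) ⟩
  v r * dw - (w r * dv - - expand r n (v ∷ w ∷ ps) vs)
    ≡⟨ exchange (v r) dw (w r) dv _ ⟩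
  - (w r * dv - (v r * dw - expand r n (v ∷ w ∷ ps) vs)) ∎
  where
  dv = colDet (suc r) n (ps ʳ++ (v ∷ vs))
  dw = colDet (suc r) n (ps ʳ++ (w ∷ vs))
  swapped : ∀ ys → colDet (suc r) n (ps ʳ++ (v ∷ w ∷ ys)) ≡ - colDet (suc r) n (ps ʳ++ (w ∷ v ∷ ys))
  swapped ys = begin
    colDet (suc r) n (ps ʳ++ (v ∷ w ∷ ys))         ≡⟨ cong (colDet (suc r) n) (ʳ++-assoc ps) ⟨
    colDet (suc r) n ((ps ʳ++ []) ++ v ∷ w ∷ ys)   ≡⟨ colDet-swap (suc r) n (ps ʳ++ []) ys ⟩
    - colDet (suc r) n ((ps ʳ++ []) ++ w ∷ v ∷ ys) ≡⟨ cong (λ us → - colDet (suc r) n us) (ʳ++-assoc ps) ⟩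
    - colDet (suc r) n (ps ʳ++ (w ∷ v ∷ ys))       ∎
  exchange : ∀ a b c d e → a * b - (c * d - - e) ≡ - (c * d - (a * b - e))
  exchange = solve-∀
expand-swap r n ps (u ∷ us) {v} {w} vs = begin
  u r * colDet (suc r) n (ps ʳ++ (us ++ v ∷ w ∷ vs)) - expand r n (u ∷ ps) (us ++ v ∷ w ∷ vs)
    ≡⟨ cong₂ (λ x y → u r * x - y) swapped (expand-swap r n (u ∷ ps) us vs) ⟩
  u r * - colDet (suc r) n (ps ʳ++ (us ++ w ∷ v ∷ vs)) - - expand r n (u ∷ ps) (us ++ w ∷ v ∷ vs)
    ≡⟨ pull (u r) (colDet (suc r) n (ps ʳ++ (us ++ w ∷ v ∷ vs))) _ ⟩
  - expand r n ps (u ∷ us ++ w ∷ v ∷ vs) ∎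
  where
  swapped : colDet (suc r) n (ps ʳ++ (us ++ v ∷ w ∷ vs)) ≡ - colDet (suc r) n (ps ʳ++ (us ++ w ∷ v ∷ vs))
  swapped = begin
    colDet (suc r) n (ps ʳ++ (us ++ v ∷ w ∷ vs))   ≡⟨ cong (colDet (suc r) n) (ʳ++-assoc ps) ⟨
    colDet (suc r) n ((ps ʳ++ us) ++ v ∷ w ∷ vs)   ≡⟨ colDet-swap (suc r) n (ps ʳ++ us) vs ⟩
    - colDet (suc r) n ((ps ʳ++ us) ++ w ∷ v ∷ vs) ≡⟨ cong (λ us → - colDet (suc r) n us) (ʳ++-assoc ps) ⟩
    - colDet (suc r) n (ps ʳ++ (us ++ w ∷ v ∷ vs)) ∎
  pull : ∀ x d e → x * - d - - e ≡ - (x * d - e)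
  pull = solve-∀

-- For nonzero `i` the two sides have different constructors.
i≡-i⇒i≡0 : ∀ i → i ≡ - i → i ≡ 0ℤ
i≡-i⇒i≡0 (+ zero) _ = refl

-- Swaps carry the first copy rightwards until the two are adjacent; swapping these shows that the
-- value is its own negative.
colDet-repeat : ∀ r n us {v} ws vs → colDet r n (us ++ v ∷ ws ++ v ∷ vs) ≡ 0ℤ
colDet-repeat r n us {v} []       vs = i≡-i⇒i≡0 _ (colDet-swap r n us vs)
colDet-repeat r n us {v} (w ∷ ws) vs = begin
  colDet r n (us ++ v ∷ w ∷ ws ++ v ∷ vs)        ≡⟨ colDet-swap r n us _ ⟩
  - colDet r n (us ++ w ∷ v ∷ ws ++ v ∷ vs)      ≡⟨ cong (λ us → - colDet r n us) (++-assoc us [ w ] _) ⟨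
  - colDet r n ((us ++ [ w ]) ++ v ∷ ws ++ v ∷ vs) ≡⟨ cong -_ (colDet-repeat r n (us ++ [ w ]) ws vs) ⟩
  0ℤ ∎

-- The combination is assumed entry by entry, which avoids function extensionality.
colDet-linear : ∀ r n us α (u v : Column) {w} → (∀ i → w i ≡ α * u i + v i) →
  colDet r n (us ∷ʳ w) ≡ α * colDet r n (us ∷ʳ u) + colDet r n (us ∷ʳ v)
expand-linear : ∀ r n ps us α (u v : Column) {w} → (∀ i → w i ≡ α * u i + v i) →
  expand r n ps (us ∷ʳ w) ≡ α * expand r n ps (us ∷ʳ u) + expand r n ps (us ∷ʳ v)

colDet-linear r zero    []      α u v eq = vanish α
  where
  vanish : ∀ α → 0ℤ ≡ α * 0ℤ + 0ℤ
  vanish = solve-∀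
colDet-linear r zero    (_ ∷ _) α u v eq = vanish α
  where
  vanish : ∀ α → 0ℤ ≡ α * 0ℤ + 0ℤ
  vanish = solve-∀
colDet-linear r (suc n) us      α u v eq = expand-linear r n [] us α u v eq

expand-linear r n ps [] α u v eq =
  trans (cong (λ x → x * d - 0ℤ) (eq r)) (distrib α (u r) (v r) d)
  where
  d = colDet (suc r) n (ps ʳ++ [])
  distrib : ∀ α x y d → (α * x + y) * d - 0ℤ ≡ α * (x * d - 0ℤ) + (y * d - 0ℤ)
  distrib = solve-∀
expand-linear r n ps (x ∷ us) α u v {w} eq =
  trans (cong₂ (λ d e → x r * d - e) minor (expand-linear r n (x ∷ ps) us α u v eq))
        (distrib α (x r) (M u) (M v) (expand r n (x ∷ ps) (us ∷ʳ u)) _)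
  where
  M = λ u → colDet (suc r) n (ps ʳ++ (us ∷ʳ u))
  assoc : ∀ u → colDet (suc r) n ((ps ʳ++ us) ∷ʳ u) ≡ M u
  assoc u = cong (colDet (suc r) n) (ʳ++-assoc ps)
  minor : M w ≡ α * M u + M v
  minor = begin
    M w                                                  ≡⟨ assoc w ⟨
    colDet (suc r) n ((ps ʳ++ us) ∷ʳ w)                  ≡⟨ colDet-linear (suc r) n (ps ʳ++ us) α u v eq ⟩
    α * colDet (suc r) n ((ps ʳ++ us) ∷ʳ u) + colDet (suc r) n ((ps ʳ++ us) ∷ʳ v)
                                                         ≡⟨ cong₂ (λ x y → α * x + y) (assoc u) (assoc v) ⟩
    α * M u + M v                                        ∎
  distrib : ∀ α x d d′ e e′ →
    x * (α * d + d′) - (α * e + e′) ≡ α * (x * d - e) + (x * d′ - e′)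
  distrib = solve-∀

colDet-zero : ∀ r ps {u} us → colDet r 0 (ps ʳ++ (u ∷ us)) ≡ 0ℤ
colDet-zero r []       us = refl
colDet-zero r (p ∷ ps) us = colDet-zero r ps (_ ∷ us)

expand-zero : ∀ r ps {p} us → expand r 0 (p ∷ ps) us ≡ 0ℤ
expand-zero r ps []       = refl
expand-zero r ps (u ∷ us) = trans
  (cong₂ (λ d e → u r * d - e) (colDet-zero (suc r) ps us) (expand-zero r (_ ∷ ps) us))
  (cong (_- 0ℤ) (ℤ.*-zeroʳ (u r)))

-- In the expansion along row `r`, the term that deletes `w` vanishes and all other minors again end
-- in `w`, so the corner factor comes out by induction.
colDet-corner : ∀ r n us {w} → (∀ i → i ℕ.< n → w (i ℕ.+ r) ≡ 0ℤ) →
  colDet r (suc n) (us ∷ʳ w) ≡ w (n ℕ.+ r) * colDet r n us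
expand-corner : ∀ r n ps us {w} → (∀ i → i ℕ.< suc n → w (i ℕ.+ r) ≡ 0ℤ) →
  expand r (suc n) ps (us ∷ʳ w) ≡ w (suc n ℕ.+ r) * expand r n ps us

colDet-corner r zero [] {w} w≡0 = unit (w r)
  where
  unit : ∀ x → x * 1ℤ - 0ℤ ≡ x * 1ℤ
  unit = solve-∀
-- More columns than rows: the junk value 0 makes both sides vanish.
colDet-corner r zero (u ∷ us) {w} w≡0 = begin
  u r * colDet (suc r) 0 (us ∷ʳ w) - expand r 0 [ u ] (us ∷ʳ w)
    ≡⟨ cong₂ (λ d e → u r * d - e) (nonempty us) (expand-zero r [] (us ∷ʳ w)) ⟩
  u r * 0ℤ - 0ℤ
    ≡⟨ vanish (u r) (w r) ⟩
  w r * 0ℤ ∎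
  where
  nonempty : ∀ us → colDet (suc r) 0 (us ∷ʳ w) ≡ 0ℤ
  nonempty []      = refl
  nonempty (_ ∷ _) = refl
  vanish : ∀ x y → x * 0ℤ - 0ℤ ≡ y * 0ℤ
  vanish = solve-∀
colDet-corner r (suc n) us w≡0 = expand-corner r n [] us w≡0

expand-corner r n ps [] {w} w≡0 =
  trans (cong (λ x → x * colDet (suc r) (suc n) (ps ʳ++ []) - 0ℤ) (w≡0 0 (ℕ.s≤s ℕ.z≤n)))
        (sym (ℤ.*-zeroʳ (w (suc n ℕ.+ r))))
expand-corner r n ps (u ∷ us) {w} w≡0 =
  trans (cong₂ (λ d e → u r * d - e) minor (expand-corner r n (u ∷ ps) us w≡0))
        (pull (u r) (w (suc n ℕ.+ r)) (colDet (suc r) n (ps ʳ++ us)) _)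
  where
  minor : colDet (suc r) (suc n) (ps ʳ++ (us ∷ʳ w)) ≡ w (suc n ℕ.+ r) * colDet (suc r) n (ps ʳ++ us)
  minor = begin
    colDet (suc r) (suc n) (ps ʳ++ (us ∷ʳ w))        ≡⟨ cong (colDet (suc r) (suc n)) (ʳ++-assoc ps) ⟨
    colDet (suc r) (suc n) ((ps ʳ++ us) ∷ʳ w)        ≡⟨ colDet-corner (suc r) n (ps ʳ++ us) shifted ⟩
    w (n ℕ.+ suc r) * colDet (suc r) n (ps ʳ++ us)   ≡⟨ cong (λ i → w i * colDet (suc r) n (ps ʳ++ us)) (ℕ.+-suc n r) ⟩
    w (suc n ℕ.+ r) * colDet (suc r) n (ps ʳ++ us)   ∎
    where
    shifted : ∀ i → i ℕ.< n → w (i ℕ.+ suc r) ≡ 0ℤ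
    shifted i i<n = trans (cong w (ℕ.+-suc i r)) (w≡0 (suc i) (ℕ.s≤s i<n))
  pull : ∀ a x d e → a * (x * d) - x * e ≡ x * (a * d - e)
  pull = solve-∀

-- Hankel determinants and replacement of their last column

module Hankel (s : ℕ → ℤ) where

  shift : ℕ → Column
  shift j i = s (j ℕ.+ i)

  hankelDet : ℕ → ℤ
  hankelDet n = colDet 0 n (applyUpTo shift n)

  det≡hankelDet : ∀ {n} (A : SquareMatrix n) →
    (∀ i j → A i j ≡ s (toℕ j ℕ.+ toℕ i)) → det A ≡ hankelDet n
  det≡hankelDet {n} A A≡s = trans
    (det≡colDet 0 A (λ j → shift (toℕ j)) λ i j →
      trans (A≡s i j) (cong (λ k → s (toℕ j ℕ.+ k)) (sym (ℕ.+-identityʳ (toℕ i)))))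
    (cong (colDet 0 n) (tabulate-toℕ n shift))
    where
    tabulate-toℕ : ∀ n (f : ℕ → Column) → tabulate {n = n} (λ j → f (toℕ j)) ≡ applyUpTo f n
    tabulate-toℕ zero    f = refl
    tabulate-toℕ (suc n) f = cong (f 0 ∷_) (tabulate-toℕ n (λ j → f (suc j)))

  -- The Hankel determinant of order n + 1 with its last column replaced.
  module LastColumn (n : ℕ) where

    Φ : Column → ℤ
    Φ w = colDet 0 (suc n) (applyUpTo shift n ∷ʳ w)

    Φ-linear : ∀ α (u v : Column) {w} → (∀ i → w i ≡ α * u i + v i) → Φ w ≡ α * Φ u + Φ v
    Φ-linear = colDet-linear 0 (suc n) (applyUpTo shift n)

    -- Linearity with coefficient 0 stands in for function extensionality.
    Φ-cong : ∀ {u w : Column} → (∀ i → w i ≡ u i) → Φ w ≡ Φ u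
    Φ-cong {u} {w} w≡u = trans (Φ-linear 0ℤ u u λ i → trans (w≡u i) (trivial (u i) (u i)))
                               (sym (trivial (Φ u) (Φ u)))
      where
      trivial : ∀ x y → y ≡ 0ℤ * x + y
      trivial = solve-∀

    Φ-shift-< : ∀ {j} → j ℕ.< n → Φ (shift j) ≡ 0ℤ
    Φ-shift-< {j} j<n with us , vs , eq ← ∈-∃++ (∈-applyUpTo⁺ shift j<n) = begin
      colDet 0 (suc n) (applyUpTo shift n ∷ʳ shift j)
        ≡⟨ cong (λ us → colDet 0 (suc n) (us ∷ʳ shift j)) eq ⟩
      colDet 0 (suc n) ((us ++ shift j ∷ vs) ++ [ shift j ])
        ≡⟨ cong (colDet 0 (suc n)) (++-assoc us (shift j ∷ vs) [ shift j ]) ⟩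
      colDet 0 (suc n) (us ++ shift j ∷ vs ++ [ shift j ])
        ≡⟨ colDet-repeat 0 (suc n) us vs [] ⟩
      0ℤ ∎

    Φ-shift-≡ : Φ (shift n) ≡ hankelDet (suc n)
    Φ-shift-≡ = cong (colDet 0 (suc n)) (applyUpTo-∷ʳ shift n)

    Φ-corner : ∀ {w} → (∀ i → i ℕ.< n → w i ≡ 0ℤ) → Φ w ≡ w n * hankelDet n
    Φ-corner {w} w≡0 = trans
      (colDet-corner 0 n (applyUpTo shift n) λ i i<n → trans (cong w (ℕ.+-identityʳ i)) (w≡0 i i<n))
      (cong (λ k → w k * hankelDet n) (ℕ.+-identityʳ n))

-- If e k is the column of L(x^i p_k) for monic p_k of degree k, then replacing
-- the last column by that of p_k has the effect of using x^k.
module Recurrent (e : ℕ → Column) (e₁ : ∀ i → e 1 i ≡ e 0 (suc i))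
  (e₊ : ∀ k i → e (2 ℕ.+ k) i ≡ e (suc k) (suc i) + e k i) where

  open Hankel (e 0) public

  module Recurrence (n : ℕ) where

    open LastColumn n public

    private
      split : ∀ j k → Φ (λ i → e (2 ℕ.+ k) (j ℕ.+ i))
        ≡ 1ℤ * Φ (λ i → e (suc k) (suc j ℕ.+ i)) + Φ (λ i → e k (j ℕ.+ i))
      split j k = Φ-linear 1ℤ (λ i → e (suc k) (suc j ℕ.+ i)) (λ i → e k (j ℕ.+ i)) λ i →
        trans (e₊ k (j ℕ.+ i)) (cong (_+ e k (j ℕ.+ i)) (sym (ℤ.*-identityˡ (e (suc k) (suc j ℕ.+ i)))))

    -- The polynomial x^j p_k has degree j + k < n, so it is spanned by columns already present. The
    -- recurrence lowers `k`, raising `j` by at most as much, until p_0 = 1 is reached.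
    Φ-shift-e-< : ∀ j k → j ℕ.+ k ℕ.< n → Φ (λ i → e k (j ℕ.+ i)) ≡ 0ℤ
    Φ-shift-e-< j 0 j<n = Φ-shift-< (subst (ℕ._< n) (ℕ.+-identityʳ j) j<n)
    Φ-shift-e-< j 1 j<n = trans (Φ-cong λ i → e₁ (j ℕ.+ i))
      (Φ-shift-e-< (suc j) 0 (subst (ℕ._< n) (ℕ.+-suc j 0) j<n))
    Φ-shift-e-< j (suc (suc k)) j<n = trans (split j k) (cong₂ (λ x y → 1ℤ * x + y)
      (Φ-shift-e-< (suc j) (suc k) (subst (ℕ._< n) (ℕ.+-suc j (suc k)) j<n))
      (Φ-shift-e-< j k (ℕ.≤-<-trans (ℕ.+-monoʳ-≤ j (ℕ.m≤n+m k 2)) j<n)))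

    -- Since p_k is monic, x^j p_k is x^n up to lower degree; the second term of the recurrence has
    -- degree n - 2 and contributes nothing.
    Φ-shift-e-≡ : ∀ j k → j ℕ.+ k ≡ n → Φ (λ i → e k (j ℕ.+ i)) ≡ hankelDet (suc n)
    Φ-shift-e-≡ j 0 j≡n = trans (cong (λ j → Φ (shift j)) (trans (sym (ℕ.+-identityʳ j)) j≡n)) Φ-shift-≡
    Φ-shift-e-≡ j 1 j≡n = trans (Φ-cong λ i → e₁ (j ℕ.+ i))
      (Φ-shift-e-≡ (suc j) 0 (trans (sym (ℕ.+-suc j 0)) j≡n))
    Φ-shift-e-≡ j (suc (suc k)) j≡n = trans (split j k) (trans (cong₂ (λ x y → 1ℤ * x + y)
      (Φ-shift-e-≡ (suc j) (suc k) (trans (sym (ℕ.+-suc j (suc k))) j≡n))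
      (Φ-shift-e-< j k (subst (j ℕ.+ k ℕ.<_) j≡n (ℕ.+-monoʳ-< j (ℕ.m≤n+m (suc k) 1)))))
      (tidy (hankelDet (suc n))))
      where
      tidy : ∀ x → 1ℤ * x + 0ℤ ≡ x
      tidy = solve-∀

    Φ-e-< : ∀ {k} → k ℕ.< n → Φ (e k) ≡ 0ℤ
    Φ-e-< {k} = Φ-shift-e-< 0 k

    Φ-e-≡ : Φ (e n) ≡ hankelDet (suc n)
    Φ-e-≡ = Φ-shift-e-≡ 0 n refl

-- Signs and parity

sgn : ℕ → ℤ
sgn n = -1ℤ ^ n

sgn-C2 : ∀ n → sgn (suc n C 2) ≡ sgn n * sgn (n C 2)
sgn-C2 n = begin
  sgn (suc n C 2)          ≡⟨ cong sgn (nCk+nC[k+1]≡[n+1]C[k+1] n 1) ⟨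
  sgn (n C 1 ℕ.+ n C 2)    ≡⟨ cong (λ k → sgn (k ℕ.+ n C 2)) (nC1≡n n) ⟩
  sgn (n ℕ.+ n C 2)        ≡⟨ ℤ.^-distribˡ-+-* -1ℤ n (n C 2) ⟩
  sgn n * sgn (n C 2)      ∎

double : ℕ → ℕ
double zero    = zero
double (suc m) = 2 ℕ.+ double m

data Parity : ℕ → Set where
  even : ∀ m → Parity (double m)
  odd  : ∀ m → Parity (suc (double m))

parity : ∀ n → Parity n
parity zero = even zero
parity (suc n) with parity n
... | even m = odd m
... | odd m  = even (suc m)

⌊double/2⌋ : ∀ m → ⌊ double m /2⌋ ≡ m
⌊double/2⌋ zero    = refl
⌊double/2⌋ (suc m) = cong suc (⌊double/2⌋ m)

⌈double/2⌉ : ∀ m → ⌈ double m /2⌉ ≡ m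
⌈double/2⌉ zero    = refl
⌈double/2⌉ (suc m) = cong suc (⌈double/2⌉ m)

double≡+ : ∀ m → double m ≡ m ℕ.+ m
double≡+ zero    = refl
double≡+ (suc m) = cong suc (trans (cong suc (double≡+ m)) (sym (ℕ.+-suc m m)))

double≡2* : ∀ m → double m ≡ 2 ℕ.* m
double≡2* m = trans (double≡+ m) (cong (m ℕ.+_) (sym (ℕ.+-identityʳ m)))

-- Moments of the functional L and orthogonality

-- moment i k = L(x^i p_k).
moment : ℕ → ℕ → ℤ
moment zero    zero    = 1ℤ
moment zero    (suc k) = 0ℤ
moment (suc i) zero    = moment i 1
moment (suc i) (suc k) = moment i (2 ℕ.+ k) - moment i k

-- L(p_k) = 0 for k > 0, and by x p_(k+1) = p_(k+2) - p_k each factor x lowers the index by at most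
-- one.
moment-< : ∀ {i k} → i ℕ.< k → moment i k ≡ 0ℤ
moment-< {zero}  {suc k} _ = refl
moment-< {suc i} {suc k} (ℕ.s≤s i<k) =
  cong₂ _-_ (moment-< (ℕ.m≤n⇒m≤o+n 2 i<k)) (moment-< i<k)

-- Only the term -p_k of x p_(k+1) survives, so each step contributes a factor -1.
moment-≡ : ∀ k → moment k k ≡ sgn k
moment-≡ zero    = refl
moment-≡ (suc k) = trans (cong₂ _-_ (moment-< (ℕ.m≤n⇒m≤1+n (ℕ.n<1+n k))) (moment-≡ k)) (neg (sgn k))
  where
  neg : ∀ x → 0ℤ - x ≡ -1ℤ * x
  neg = solve-∀

-- The recurrence preserves the parity of `i + k`, so an odd sum never reaches L(p_0), the only
-- nonzero starting value.
moment-odd : ∀ i k m → i ℕ.+ k ≡ suc (double m) → moment i k ≡ 0ℤ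
moment-odd zero    (suc k) m       eq = refl
moment-odd (suc i) zero    m       eq = moment-odd i 1 m (trans (ℕ.+-suc i 0) eq)
moment-odd (suc i) (suc k) zero    eq with () ← trans (sym (ℕ.+-suc i k)) (ℕ.suc-injective eq)
moment-odd (suc i) (suc k) (suc m) eq = cong₂ _-_
  (moment-odd i (2 ℕ.+ k) (suc m) (trans (ℕ.+-suc i (suc k)) eq))
  (moment-odd i k m (ℕ.suc-injective (trans (sym (ℕ.+-suc i k)) (ℕ.suc-injective eq))))

-- Even moments: ballot numbers and Catalan numbers

ballot : ℕ → ℕ → ℤ
ballot n zero    = 1ℤ
ballot n (suc m) = + (n C suc m) - + (n C m)

ballot-suc : ∀ n m → ballot (suc n) (suc m) ≡ ballot n (suc m) + ballot n m
ballot-suc n zero    = begin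
  + (suc n C 1) - 1ℤ             ≡⟨ cong (λ k → + k - 1ℤ) (nCk+nC[k+1]≡[n+1]C[k+1] n 0) ⟨
  1ℤ + + (n C 1) - 1ℤ            ≡⟨ regroup (+ (n C 1)) ⟩
  + (n C 1) - 1ℤ + 1ℤ            ∎
  where
  regroup : ∀ x → 1ℤ + x - 1ℤ ≡ x - 1ℤ + 1ℤ
  regroup = solve-∀
ballot-suc n (suc m) = begin
  + (suc n C (2 ℕ.+ m)) - + (suc n C suc m)
    ≡⟨ cong₂ (λ j k → + j - + k) (nCk+nC[k+1]≡[n+1]C[k+1] n (suc m)) (nCk+nC[k+1]≡[n+1]C[k+1] n m) ⟨
  (+ (n C suc m) + + (n C (2 ℕ.+ m))) - (+ (n C m) + + (n C suc m))
    ≡⟨ regroup (+ (n C suc m)) (+ (n C (2 ℕ.+ m))) (+ (n C m)) ⟩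
  + (n C (2 ℕ.+ m)) - + (n C suc m) + (+ (n C suc m) - + (n C m)) ∎
  where
  regroup : ∀ a b c → (a + b) - (c + a) ≡ b - a + (a - c)
  regroup = solve-∀

-- Symmetry of the two middle binomial coefficients. In terms of paths, none that stays nonnegative
-- ends at height -1.
ballot-middle : ∀ m → ballot (suc (double m)) (suc m) ≡ 0ℤ
ballot-middle m = ℤ.i≡j⇒i-j≡0 (cong +_ (sym (begin
  n C m             ≡⟨ nCk≡nC[n∸k] (ℕ.m≤n⇒m≤1+n (subst (m ℕ.≤_) (sym (double≡+ m)) (ℕ.m≤m+n m m))) ⟩
  n C (n ℕ.∸ m)     ≡⟨ cong (n C_) n∸m ⟩
  n C suc m         ∎)))
  where
  n = suc (double m)
  n∸m : n ℕ.∸ m ≡ suc m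
  n∸m = trans (cong (λ k → suc k ℕ.∸ m) (double≡+ m)) (ℕ.m+n∸n≡m (suc m) m)

-- Up to sign, both sides count the paths of `double m + k` unit steps, `m` of them down, that end
-- at height `k` and never go below 0. The proof matches the recurrence of `moment` with
-- `ballot-suc`.
moment-ballot : ∀ m k → moment (double m ℕ.+ k) k ≡ sgn (m ℕ.+ k) * ballot (double m ℕ.+ k) m
moment-ballot zero    k = trans (moment-≡ k) (sym (ℤ.*-identityʳ (sgn k)))
moment-ballot (suc m) zero
  rewrite ℕ.+-identityʳ (double m) | ℕ.+-identityʳ m = begin
  moment (1 ℕ.+ n) 1
    ≡⟨ cong (λ i → moment i 1) (ℕ.+-comm n 1) ⟨
  moment (n ℕ.+ 1) 1
    ≡⟨ moment-ballot m 1 ⟩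
  sgn (m ℕ.+ 1) * ballot (n ℕ.+ 1) m
    ≡⟨ cong₂ (λ k i → sgn k * ballot i m) (ℕ.+-comm m 1) (ℕ.+-comm n 1) ⟩
  sgn (suc m) * ballot (suc n) m
    ≡⟨ cong (sgn (suc m) *_) (ℤ.+-identityˡ (ballot (suc n) m)) ⟨
  sgn (suc m) * (0ℤ + ballot (suc n) m)
    -- The zero is the ballot number for height -1; it completes `ballot-suc` at the boundary
    -- `k = 0`.
    ≡⟨ cong (λ x → sgn (suc m) * (x + ballot (suc n) m)) (ballot-middle m) ⟨
  sgn (suc m) * (ballot (suc n) (suc m) + ballot (suc n) m)
    ≡⟨ cong (sgn (suc m) *_) (ballot-suc (suc n) m) ⟨
  sgn (suc m) * ballot (2 ℕ.+ n) (suc m) ∎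
  where n = double m
moment-ballot (suc m) (suc k) = begin
  moment (2 ℕ.+ (double m ℕ.+ suc k)) (suc k)
    ≡⟨ cong (λ i → moment (2 ℕ.+ i) (suc k)) (ℕ.+-suc (double m) k) ⟩
  moment n (2 ℕ.+ k) - moment n k
    ≡⟨ cong₂ _-_ (trans (cong (λ i → moment i (2 ℕ.+ k)) (sym n≡)) (moment-ballot m (2 ℕ.+ k)))
                 (moment-ballot (suc m) k) ⟩
  sgn (m ℕ.+ (2 ℕ.+ k)) * ballot (double m ℕ.+ (2 ℕ.+ k)) m - sgn (suc m ℕ.+ k) * ballot n (suc m)
    ≡⟨ cong₂ (λ j i → sgn j * ballot i m - sgn (suc m ℕ.+ k) * ballot n (suc m)) m≡ n≡ ⟩
  sgn (2 ℕ.+ (m ℕ.+ k)) * ballot n m - sgn (suc m ℕ.+ k) * ballot n (suc m)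
    ≡⟨ regroup (sgn (m ℕ.+ k)) (ballot n m) (ballot n (suc m)) ⟩
  sgn (2 ℕ.+ (m ℕ.+ k)) * (ballot n (suc m) + ballot n m)
    ≡⟨ cong (sgn (2 ℕ.+ (m ℕ.+ k)) *_) (ballot-suc n m) ⟨
  sgn (2 ℕ.+ (m ℕ.+ k)) * ballot (suc n) (suc m)
    ≡⟨ cong₂ (λ j i → sgn (suc j) * ballot (2 ℕ.+ i) (suc m)) (ℕ.+-suc m k) (ℕ.+-suc (double m) k) ⟨
  sgn (suc m ℕ.+ suc k) * ballot (double (suc m) ℕ.+ suc k) (suc m) ∎
  where
  n = 2 ℕ.+ (double m ℕ.+ k)
  n≡ : double m ℕ.+ (2 ℕ.+ k) ≡ n
  n≡ = trans (ℕ.+-suc (double m) (suc k)) (cong suc (ℕ.+-suc (double m) k))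
  m≡ : m ℕ.+ (2 ℕ.+ k) ≡ 2 ℕ.+ (m ℕ.+ k)
  m≡ = trans (ℕ.+-suc m (suc k)) (cong suc (ℕ.+-suc m k))
  regroup : ∀ s a b → -1ℤ * (-1ℤ * s) * a - -1ℤ * s * b ≡ -1ℤ * (-1ℤ * s) * (b + a)
  regroup = solve-∀

C-absorption : ∀ n k → suc k ℕ.* (suc n C suc k) ≡ suc n ℕ.* (n C k)
C-absorption zero    zero    = refl
C-absorption zero    (suc k) = ℕ.*-zeroʳ (2 ℕ.+ k)
C-absorption (suc n) zero    = begin
  1 ℕ.* ((2 ℕ.+ n) C 1)      ≡⟨ ℕ.*-identityˡ _ ⟩
  (2 ℕ.+ n) C 1              ≡⟨ nC1≡n (2 ℕ.+ n) ⟩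
  2 ℕ.+ n                  ≡⟨ ℕ.*-identityʳ (2 ℕ.+ n) ⟨
  (2 ℕ.+ n) ℕ.* 1          ∎
C-absorption (suc n) (suc k) = begin
  (2 ℕ.+ k) ℕ.* ((2 ℕ.+ n) C (2 ℕ.+ k))
    ≡⟨ cong ((2 ℕ.+ k) ℕ.*_) (nCk+nC[k+1]≡[n+1]C[k+1] (suc n) (suc k)) ⟨
  (2 ℕ.+ k) ℕ.* (a ℕ.+ b)
    -- Writing k + 2 = 1 + (k + 1) in front of `a` turns both products into instances of the
    -- induction hypothesis.
    ≡⟨ split k a b ⟩
  a ℕ.+ (suc k ℕ.* a ℕ.+ (2 ℕ.+ k) ℕ.* b)
    ≡⟨ cong₂ (λ x y → a ℕ.+ (x ℕ.+ y)) (C-absorption n k) (C-absorption n (suc k)) ⟩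
  a ℕ.+ (suc n ℕ.* (n C k) ℕ.+ suc n ℕ.* (n C suc k))
    ≡⟨ cong (a ℕ.+_) (ℕ.*-distribˡ-+ (suc n) (n C k) (n C suc k)) ⟨
  a ℕ.+ suc n ℕ.* (n C k ℕ.+ n C suc k)
    ≡⟨ cong (λ x → a ℕ.+ suc n ℕ.* x) (nCk+nC[k+1]≡[n+1]C[k+1] n k) ⟩
  (2 ℕ.+ n) ℕ.* a ∎
  where
  a = suc n C suc k
  b = suc n C (2 ℕ.+ k)
  split : ∀ k a b → (2 ℕ.+ k) ℕ.* (a ℕ.+ b) ≡ a ℕ.+ (suc k ℕ.* a ℕ.+ (2 ℕ.+ k) ℕ.* b)
  split = ℕ-Ring.solve-∀

-- With x = C(2m+2, m+1) and y = C(2m+2, m), absorption gives (m+1) x = (m+2) y, hence (m+2)(x - y)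
-- = x, so the division in `catalan` is exact.
ballot-catalan : ∀ m → ballot (double m) m ≡ + catalan m
ballot-catalan zero    = refl
ballot-catalan (suc m) = begin
  + x - + y                         ≡⟨ ℤ.m-n≡m⊖n x y ⟩
  x ⊖ y                             ≡⟨ ℤ.⊖-≥ y≤x ⟩
  + (x ℕ.∸ y)                       ≡⟨ cong +_ (ℕ.m*n/n≡m (x ℕ.∸ y) (2 ℕ.+ m)) ⟨
  + ((x ℕ.∸ y) ℕ.* (2 ℕ.+ m) ℕ./ (2 ℕ.+ m))
                                    ≡⟨ cong (λ k → + (k ℕ./ (2 ℕ.+ m))) exact ⟩
  + (x ℕ./ (2 ℕ.+ m))               ≡⟨ cong (λ k → + ((k C suc m) ℕ./ (2 ℕ.+ m))) (double≡2* (suc m)) ⟩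
  + catalan (suc m)                 ∎
  where
  n = double (suc m)
  x = n C suc m
  y = n C m
  -- Pascal's rule and absorption give (m+1)(y + x) = (2m+3) y, and 2m+3 = (m+1) + (m+2).
  ratio : suc m ℕ.* x ≡ (2 ℕ.+ m) ℕ.* y
  ratio = ℕ.+-cancelˡ-≡ (suc m ℕ.* y) _ _ (begin
    suc m ℕ.* y ℕ.+ suc m ℕ.* x          ≡⟨ ℕ.*-distribˡ-+ (suc m) y x ⟨
    suc m ℕ.* (y ℕ.+ x)                  ≡⟨ cong (suc m ℕ.*_) (nCk+nC[k+1]≡[n+1]C[k+1] n m) ⟩
    suc m ℕ.* (suc n C suc m)            ≡⟨ C-absorption n m ⟩
    suc n ℕ.* y                          ≡⟨ cong (λ k → (3 ℕ.+ k) ℕ.* y) (double≡+ m) ⟩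
    (3 ℕ.+ (m ℕ.+ m)) ℕ.* y              ≡⟨ regroup m y ⟩
    suc m ℕ.* y ℕ.+ (2 ℕ.+ m) ℕ.* y      ∎)
    where
    regroup : ∀ m y → (3 ℕ.+ (m ℕ.+ m)) ℕ.* y ≡ suc m ℕ.* y ℕ.+ (2 ℕ.+ m) ℕ.* y
    regroup = ℕ-Ring.solve-∀
  y≤x : y ℕ.≤ x
  y≤x = ℕ.*-cancelˡ-≤ (suc m) (subst (suc m ℕ.* y ℕ.≤_) (sym ratio) (ℕ.m≤n+m (suc m ℕ.* y) y))
  exact : (x ℕ.∸ y) ℕ.* (2 ℕ.+ m) ≡ x
  exact = begin
    (x ℕ.∸ y) ℕ.* (2 ℕ.+ m)                     ≡⟨ ℕ.*-distribʳ-∸ (2 ℕ.+ m) x y ⟩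
    x ℕ.* (2 ℕ.+ m) ℕ.∸ y ℕ.* (2 ℕ.+ m)         ≡⟨ cong₂ ℕ._∸_ (ℕ.*-comm x (2 ℕ.+ m)) (trans (ℕ.*-comm y (2 ℕ.+ m)) (sym ratio)) ⟩
    (x ℕ.+ suc m ℕ.* x) ℕ.∸ suc m ℕ.* x         ≡⟨ ℕ.m+n∸n≡m x (suc m ℕ.* x) ⟩
    x                                           ∎

-- The case `k = 0` of `moment-ballot`. It links the functional, which `moment` encodes through
-- orthogonality, to the Catalan numbers.
moment-double : ∀ m → moment (double m) 0 ≡ sgn m * + catalan m
moment-double m = begin
  moment (double m) 0                                ≡⟨ cong (λ i → moment i 0) (ℕ.+-identityʳ (double m)) ⟨
  moment (double m ℕ.+ 0) 0                          ≡⟨ moment-ballot m 0 ⟩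
  sgn (m ℕ.+ 0) * ballot (double m ℕ.+ 0) m          ≡⟨ cong₂ (λ k n → sgn k * ballot n m) (ℕ.+-identityʳ m) (ℕ.+-identityʳ (double m)) ⟩
  sgn m * ballot (double m) m                        ≡⟨ cong (sgn m *_) (ballot-catalan m) ⟩
  sgn m * + catalan m                                ∎

-- The weight 1 + x and the sequence c

-- e k i = L((1 + x) x^i p_k).
e : ℕ → Column
e k i = moment i k + moment (suc i) k

-- Of two consecutive moments the one of odd degree vanishes, so the sum in `e 0 n` keeps just the
-- even one.
c≡e₀ : ∀ n → c n ≡ e 0 n
c≡e₀ n with parity n
... | even zero    = refl
... | even (suc m) = begin
  sgn ⌈ double (suc m) /2⌉ * + catalan ⌈ double (suc m) /2⌉
    ≡⟨ cong (λ k → sgn k * + catalan k) (⌈double/2⌉ (suc m)) ⟩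
  sgn (suc m) * + catalan (suc m)
    ≡⟨ moment-double (suc m) ⟨
  moment (double (suc m)) 0
    ≡⟨ ℤ.+-identityʳ _ ⟨
  moment (double (suc m)) 0 + 0ℤ
    ≡⟨ cong (λ x → moment (double (suc m)) 0 + x)
         (moment-odd (suc (double (suc m))) 0 (suc m) (ℕ.+-identityʳ _)) ⟨
  e 0 (double (suc m)) ∎
... | odd m        = begin
  -- `⌈ n /2⌉` unfolds to `⌊ suc n /2⌋`.
  sgn ⌊ double (suc m) /2⌋ * + catalan ⌊ double (suc m) /2⌋
    ≡⟨ cong (λ k → sgn k * + catalan k) (⌊double/2⌋ (suc m)) ⟩
  sgn (suc m) * + catalan (suc m)
    ≡⟨ moment-double (suc m) ⟨
  moment (double (suc m)) 0
    ≡⟨ ℤ.+-identityˡ _ ⟨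
  0ℤ + moment (double (suc m)) 0
    ≡⟨ cong (_+ moment (double (suc m)) 0)
         (moment-odd (suc (double m)) 0 m (ℕ.+-identityʳ _)) ⟨
  e 0 (suc (double m)) ∎

e₊ : ∀ k i → e (2 ℕ.+ k) i ≡ e (suc k) (suc i) + e k i
e₊ k i = telescope (moment i (2 ℕ.+ k)) (moment i k) (moment (suc i) (2 ℕ.+ k)) (moment (suc i) k)
  where
  telescope : ∀ a b c d → a + c ≡ ((a - b) + (c - d)) + (b + d)
  telescope = solve-∀

-- The weight 1 + x raises the degree by one, hence the gap of two.
e-< : ∀ {i k} → suc i ℕ.< k → e k i ≡ 0ℤ
e-< 1+i<k = cong₂ _+_ (moment-< (ℕ.<-trans (ℕ.n<1+n _) 1+i<k)) (moment-< 1+i<k)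

fib-nonZero : ∀ n → ℕ.NonZero (fib (suc n))
fib-nonZero zero    = _
fib-nonZero (suc n) = ℕ.>-nonZero (ℕ.≤-trans (ℕ.>-nonZero⁻¹ _ {{fib-nonZero n}}) (ℕ.m≤m+n _ _))

F : ℕ → ℤ
F n = + fib n

-- The determinants of c(i + j)

module First where

  open Recurrent e (λ i → refl) e₊ public

  -- The column of F_(k+1) p_(k+1) + F_(k+2) p_k, which vanishes at x = -1.
  kernel : ℕ → Column
  kernel k i = F (1 ℕ.+ k) * moment i (suc k) + F (2 ℕ.+ k) * moment i k

  -- Iterated, this writes the kernel as 1 + x times the sum of F_(j+1) p_j over j ≤ k, a cofactor
  -- of degree k with leading coefficient F_(k+1).
  kernel-suc : ∀ k i → kernel (suc k) i ≡ F (2 ℕ.+ k) * e (suc k) i + kernel k i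
  kernel-suc k i = telescope (F (1 ℕ.+ k)) (F (2 ℕ.+ k)) (moment i k) (moment i (1 ℕ.+ k)) (moment i (2 ℕ.+ k))
    where
    telescope : ∀ f g a b c → g * c + (g + f) * b ≡ g * (b + (c - a)) + (f * b + g * a)
    telescope = solve-∀

  kernel-0 : ∀ i → kernel 0 i ≡ e 0 i
  kernel-0 i = swap (moment i 1) (moment i 0)
    where
    swap : ∀ a b → 1ℤ * a + 1ℤ * b ≡ b + a
    swap = solve-∀

  open Recurrence

  Φ-kernel-< : ∀ n k → k ℕ.< n → Φ n (kernel k) ≡ 0ℤ
  Φ-kernel-< n zero    0<n = trans (Φ-cong n kernel-0) (Φ-e-< n 0<n)
  Φ-kernel-< n (suc k) k<n = begin
    Φ n (kernel (suc k))
      ≡⟨ Φ-linear n (F (2 ℕ.+ k)) (e (suc k)) (kernel k) (kernel-suc k) ⟩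
    F (2 ℕ.+ k) * Φ n (e (suc k)) + Φ n (kernel k)
      ≡⟨ cong₂ (λ x y → F (2 ℕ.+ k) * x + y) (Φ-e-< n k<n) (Φ-kernel-< n k (ℕ.<-trans (ℕ.n<1+n k) k<n)) ⟩
    F (2 ℕ.+ k) * 0ℤ + 0ℤ
      ≡⟨ vanish (F (2 ℕ.+ k)) ⟩
    0ℤ ∎
    where
    vanish : ∀ x → x * 0ℤ + 0ℤ ≡ 0ℤ
    vanish = solve-∀

  -- Only the summand F_(n+1) p_n of the cofactor has degree n; the others lie in the span of the
  -- other columns.
  Φ-kernel : ∀ n → Φ n (kernel n) ≡ F (1 ℕ.+ n) * hankelDet (suc n)
  Φ-kernel zero    = begin
    Φ 0 (kernel 0)       ≡⟨ Φ-cong 0 kernel-0 ⟩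
    Φ 0 (e 0)            ≡⟨ Φ-e-≡ 0 ⟩
    hankelDet 1          ≡⟨ ℤ.*-identityˡ (hankelDet 1) ⟨
    1ℤ * hankelDet 1     ∎
  Φ-kernel (suc n) = begin
    Φ (suc n) (kernel (suc n))
      ≡⟨ Φ-linear (suc n) (F (2 ℕ.+ n)) (e (suc n)) (kernel n) (kernel-suc n) ⟩
    F (2 ℕ.+ n) * Φ (suc n) (e (suc n)) + Φ (suc n) (kernel n)
      ≡⟨ cong₂ (λ x y → F (2 ℕ.+ n) * x + y) (Φ-e-≡ (suc n)) (Φ-kernel-< (suc n) n (ℕ.n<1+n n)) ⟩
    F (2 ℕ.+ n) * hankelDet (2 ℕ.+ n) + 0ℤ
      ≡⟨ ℤ.+-identityʳ _ ⟩
    F (2 ℕ.+ n) * hankelDet (2 ℕ.+ n) ∎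

  kernel-< : ∀ n i → i ℕ.< n → kernel n i ≡ 0ℤ
  kernel-< n i i<n = trans
    (cong₂ (λ x y → F (1 ℕ.+ n) * x + F (2 ℕ.+ n) * y) (moment-< (ℕ.m<n⇒m<1+n i<n)) (moment-< i<n))
    (vanish (F (1 ℕ.+ n)) (F (2 ℕ.+ n)))
    where
    vanish : ∀ f g → f * 0ℤ + g * 0ℤ ≡ 0ℤ
    vanish = solve-∀

  kernel-≡ : ∀ n → kernel n n ≡ F (2 ℕ.+ n) * sgn n
  kernel-≡ n = trans
    (cong₂ (λ x y → F (1 ℕ.+ n) * x + F (2 ℕ.+ n) * y) (moment-< (ℕ.n<1+n n)) (moment-≡ n))
    (tidy (F (1 ℕ.+ n)) (F (2 ℕ.+ n) * sgn n))
    where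
    tidy : ∀ f x → f * 0ℤ + x ≡ x
    tidy = solve-∀

  -- `Φ` of the kernel column evaluated twice: by column operations and by the corner entry.
  recurrence : ∀ n → F (1 ℕ.+ n) * hankelDet (suc n) ≡ F (2 ℕ.+ n) * sgn n * hankelDet n
  recurrence n = begin
    F (1 ℕ.+ n) * hankelDet (suc n)          ≡⟨ Φ-kernel n ⟨
    Φ n (kernel n)                           ≡⟨ Φ-corner n (kernel-< n) ⟩
    kernel n n * hankelDet n                 ≡⟨ cong (_* hankelDet n) (kernel-≡ n) ⟩
    F (2 ℕ.+ n) * sgn n * hankelDet n        ∎

  hankelDet≡ : ∀ n → hankelDet n ≡ sgn (n C 2) * F (1 ℕ.+ n)
  hankelDet≡ zero    = refl
  hankelDet≡ (suc n) = ℤ.*-cancelˡ-≡ (F (1 ℕ.+ n)) _ _ {{fib-nonZero n}} (begin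
    F (1 ℕ.+ n) * hankelDet (suc n)
      ≡⟨ recurrence n ⟩
    F (2 ℕ.+ n) * sgn n * hankelDet n
      ≡⟨ cong (F (2 ℕ.+ n) * sgn n *_) (hankelDet≡ n) ⟩
    F (2 ℕ.+ n) * sgn n * (sgn (n C 2) * F (1 ℕ.+ n))
      ≡⟨ regroup (F (2 ℕ.+ n)) (sgn n) (sgn (n C 2)) (F (1 ℕ.+ n)) ⟩
    F (1 ℕ.+ n) * (sgn n * sgn (n C 2) * F (2 ℕ.+ n))
      ≡⟨ cong (λ x → F (1 ℕ.+ n) * (x * F (2 ℕ.+ n))) (sgn-C2 n) ⟨
    F (1 ℕ.+ n) * (sgn (suc n C 2) * F (2 ℕ.+ n)) ∎)
    where
    regroup : ∀ g x y f → g * x * (y * f) ≡ f * (x * y * g)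
    regroup = solve-∀

-- The determinants of c(i + j + 1)

module Second where

  open Recurrent (λ k i → e k (suc i)) (λ i → refl) (λ k i → e₊ k (suc i)) public
  open Recurrence

  -- x (1 + x) Q for Q of degree n: (1 + x) p_(n+1) if n = 2m, and
  -- F_(n+1) p_(n+2) - F_(n+3) p_n if n = 2m - 1. As oddKernel m belongs to
  -- n = 2m - 1, its value at 0 is that of Q = 0.
  evenKernel : ℕ → Column
  evenKernel m = e (suc (double m))

  oddKernel : ℕ → Column
  oddKernel zero    i = 0ℤ
  oddKernel (suc m) i =
    F (2 ℕ.+ double m) * moment i (3 ℕ.+ double m) - F (4 ℕ.+ double m) * moment i (1 ℕ.+ double m)

  -- Iterated, p_(2m+1) is x times the sum of p_(2j) over j ≤ m, so Q is that sum, monic of degree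
  -- 2m.
  evenKernel-suc : ∀ m i → evenKernel (suc m) i ≡ 1ℤ * e (double (suc m)) (suc i) + evenKernel m i
  evenKernel-suc m i = trans (e₊ (suc (double m)) i)
    (cong (_+ evenKernel m i) (sym (ℤ.*-identityˡ (e (double (suc m)) (suc i)))))

  -- Divided by x (1 + x), the right side is F_(2m+2) (p_(2m+1) - Q) plus the previous cofactor, Q
  -- being that of `evenKernel m`. The leading coefficient is thus F_(2m+2).
  oddKernel-suc : ∀ m i → oddKernel (suc m) i
    ≡ F (2 ℕ.+ double m) * e (suc (double m)) (suc i) + (- F (2 ℕ.+ double m) * evenKernel m i + oddKernel m i)
  -- Separate because x p_0 = p_1 has no second term; here 1 = F_2 and 3 = F_4.
  oddKernel-suc zero    i = identity (moment i 0) (moment i 1) (moment i 2) (moment i 3)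
    where
    identity : ∀ a b c d →
      1ℤ * d - + 3 * b ≡ 1ℤ * ((c - a) + (d - b - b)) + (- 1ℤ * (b + (c - a)) + 0ℤ)
    identity = solve-∀
  oddKernel-suc (suc m) i = identity (F (2 ℕ.+ double m)) (F (3 ℕ.+ double m))
    (moment i (1 ℕ.+ double m)) (moment i (2 ℕ.+ double m)) (moment i (3 ℕ.+ double m))
    (moment i (4 ℕ.+ double m)) (moment i (5 ℕ.+ double m))
    where
    -- The larger Fibonacci numbers unfold to sums of the consecutive ones `g` and `h`.
    identity : ∀ g h a₁ a₂ a₃ a₄ a₅ →
      (h + g) * a₅ - (((h + g) + h) + (h + g)) * a₃
        ≡ (h + g) * ((a₄ - a₂) + ((a₅ - a₃) - (a₃ - a₁)))
          + (- (h + g) * (a₃ + (a₄ - a₂)) + (g * a₃ - (h + g) * a₁))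
    identity = solve-∀

  Φ-evenKernel-suc : ∀ n m →
    Φ n (evenKernel (suc m)) ≡ 1ℤ * Φ n (λ i → e (double (suc m)) (suc i)) + Φ n (evenKernel m)
  Φ-evenKernel-suc n m =
    Φ-linear n 1ℤ (λ i → e (double (suc m)) (suc i)) (evenKernel m) (evenKernel-suc m)

  Φ-evenKernel-< : ∀ n m → double m ℕ.< n → Φ n (evenKernel m) ≡ 0ℤ
  -- `e 1 i` and `e 0 (suc i)` agree by definition, since p_1 = x p_0.
  Φ-evenKernel-< n zero    m<n = Φ-e-< n m<n
  Φ-evenKernel-< n (suc m) m<n = trans (Φ-evenKernel-suc n m) (cong₂ (λ x y → 1ℤ * x + y)
    (Φ-e-< n m<n) (Φ-evenKernel-< n m (ℕ.≤-<-trans (ℕ.m≤n+m (double m) 2) m<n)))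

  Φ-evenKernel : ∀ m → Φ (double m) (evenKernel m) ≡ hankelDet (suc (double m))
  Φ-evenKernel zero    = Φ-e-≡ 0
  Φ-evenKernel (suc m) = begin
    Φ n (evenKernel (suc m))                          ≡⟨ Φ-evenKernel-suc n m ⟩
    1ℤ * Φ n (λ i → e n (suc i)) + Φ n (evenKernel m) ≡⟨ cong₂ (λ x y → 1ℤ * x + y) (Φ-e-≡ n) (Φ-evenKernel-< n m (ℕ.m<n+m (double m) (ℕ.s≤s ℕ.z≤n))) ⟩
    1ℤ * hankelDet (suc n) + 0ℤ                       ≡⟨ tidy (hankelDet (suc n)) ⟩
    hankelDet (suc n)                                 ∎
    where
    n = double (suc m)
    tidy : ∀ x → 1ℤ * x + 0ℤ ≡ x
    tidy = solve-∀

  Φ-oddKernel-suc : ∀ n m → double m ℕ.< n →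
    Φ n (oddKernel (suc m)) ≡ F (2 ℕ.+ double m) * Φ n (λ i → e (suc (double m)) (suc i)) + Φ n (oddKernel m)
  Φ-oddKernel-suc n m m<n = begin
    Φ n (oddKernel (suc m))
      ≡⟨ Φ-linear n x e′ rest (oddKernel-suc m) ⟩
    x * Φ n e′ + Φ n rest
      ≡⟨ cong (λ y → x * Φ n e′ + y) (Φ-linear n (- x) (evenKernel m) (oddKernel m) (λ i → refl)) ⟩
    x * Φ n e′ + (- x * Φ n (evenKernel m) + Φ n (oddKernel m))
      ≡⟨ cong (λ y → x * Φ n e′ + (- x * y + Φ n (oddKernel m))) (Φ-evenKernel-< n m m<n) ⟩
    x * Φ n e′ + (- x * 0ℤ + Φ n (oddKernel m))
      ≡⟨ tidy x (Φ n e′) (Φ n (oddKernel m)) ⟩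
    x * Φ n e′ + Φ n (oddKernel m) ∎
    where
    x = F (2 ℕ.+ double m)
    e′ rest : Column
    e′ i = e (suc (double m)) (suc i)
    rest i = - x * evenKernel m i + oddKernel m i
    tidy : ∀ x y z → x * y + (- x * 0ℤ + z) ≡ x * y + z
    tidy = solve-∀

  -- For positive `m` the cofactor of `oddKernel m` has degree 2m - 1, so 2m ≤ n already puts it
  -- below degree n.
  Φ-oddKernel-≤ : ∀ n m → double m ℕ.≤ n → Φ n (oddKernel m) ≡ 0ℤ
  Φ-oddKernel-≤ n zero    _   = Φ-corner n (λ _ _ → refl)
  Φ-oddKernel-≤ n (suc m) m<n = trans (Φ-oddKernel-suc n m (ℕ.<-trans (ℕ.n<1+n _) m<n))
    (trans (cong₂ (λ y z → x * y + z) (Φ-e-< n m<n) (Φ-oddKernel-≤ n m (ℕ.≤-trans (ℕ.m≤n+m _ 2) m<n)))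
           (vanish x))
    where
    x = F (2 ℕ.+ double m)
    vanish : ∀ x → x * 0ℤ + 0ℤ ≡ 0ℤ
    vanish = solve-∀

  Φ-oddKernel : ∀ m → Φ (suc (double m)) (oddKernel (suc m)) ≡ F (2 ℕ.+ double m) * hankelDet (double (suc m))
  Φ-oddKernel m = begin
    Φ n (oddKernel (suc m))
      ≡⟨ Φ-oddKernel-suc n m (ℕ.n<1+n _) ⟩
    x * Φ n (λ i → e n (suc i)) + Φ n (oddKernel m)
      ≡⟨ cong₂ (λ y z → x * y + z) (Φ-e-≡ n) (Φ-oddKernel-≤ n m (ℕ.n≤1+n _)) ⟩
    x * hankelDet (suc n) + 0ℤ
      ≡⟨ ℤ.+-identityʳ _ ⟩
    x * hankelDet (suc n) ∎
    where
    n = suc (double m)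
    x = F (2 ℕ.+ double m)

  -- The cofactor is monic and the corner entry is L(x^(n+1) p_(n+1)), so only a sign appears.
  recurrence-even : ∀ m → let n = double m in hankelDet (suc n) ≡ sgn (suc n) * hankelDet n
  recurrence-even m = begin
    hankelDet (suc n)                ≡⟨ Φ-evenKernel m ⟨
    Φ n (evenKernel m)               ≡⟨ Φ-corner n (λ i i<n → e-< (ℕ.s≤s i<n)) ⟩
    e (suc n) n * hankelDet n        ≡⟨ cong (_* hankelDet n) corner ⟩
    sgn (suc n) * hankelDet n        ∎
    where
    n = double m
    corner : e (suc n) n ≡ sgn (suc n)
    corner = trans (cong₂ _+_ (moment-< (ℕ.n<1+n n)) (moment-≡ (suc n))) (ℤ.+-identityˡ (sgn (suc n)))

  -- The cofactor has leading coefficient F_(n+1). At the corner only -F_(n+3) L(x^n p_n) remains,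
  -- whose minus sign turns (-1)^n into (-1)^(n+1).
  recurrence-odd : ∀ m → let n = suc (double m) in
    F (1 ℕ.+ n) * hankelDet (suc n) ≡ F (3 ℕ.+ n) * sgn (suc n) * hankelDet n
  recurrence-odd m = begin
    F (1 ℕ.+ n) * hankelDet (suc n)               ≡⟨ Φ-oddKernel m ⟨
    Φ n (oddKernel (suc m))                       ≡⟨ Φ-corner n below ⟩
    oddKernel (suc m) n * hankelDet n             ≡⟨ cong (_* hankelDet n) corner ⟩
    F (3 ℕ.+ n) * sgn (suc n) * hankelDet n       ∎
    where
    n = suc (double m)
    below : ∀ i → i ℕ.< n → oddKernel (suc m) i ≡ 0ℤ
    below i i<n = trans
      (cong₂ (λ x y → F (1 ℕ.+ n) * x - F (3 ℕ.+ n) * y) (moment-< (ℕ.m≤n⇒m≤o+n 2 i<n)) (moment-< i<n))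
      (vanish (F (1 ℕ.+ n)) (F (3 ℕ.+ n)))
      where
      vanish : ∀ f g → f * 0ℤ - g * 0ℤ ≡ 0ℤ
      vanish = solve-∀
    corner : oddKernel (suc m) n ≡ F (3 ℕ.+ n) * sgn (suc n)
    corner = trans
      (cong₂ (λ x y → F (1 ℕ.+ n) * x - F (3 ℕ.+ n) * y) (moment-< (ℕ.m<n+m n (ℕ.s≤s {n = 1} ℕ.z≤n))) (moment-≡ n))
      (tidy (F (1 ℕ.+ n)) (F (3 ℕ.+ n)) (sgn n))
      where
      tidy : ∀ f g s → f * 0ℤ - g * s ≡ g * (-1ℤ * s)
      tidy = solve-∀

  -- An odd order keeps the Fibonacci factor of the even order before it; the next even order moves
  -- its index up by two, whence the floor in the final formula.
  hankelDet-even : ∀ m → let n = double m in hankelDet n ≡ sgn (suc n C 2) * F (2 ℕ.+ n)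
  hankelDet-odd  : ∀ m → let n = suc (double m) in hankelDet n ≡ sgn (suc n C 2) * F (1 ℕ.+ n)

  hankelDet-even zero    = refl
  hankelDet-even (suc m) = ℤ.*-cancelˡ-≡ (F (1 ℕ.+ n)) _ _ {{fib-nonZero n}} (begin
    F (1 ℕ.+ n) * hankelDet (suc n)
      ≡⟨ recurrence-odd m ⟩
    F (3 ℕ.+ n) * sgn (suc n) * hankelDet n
      ≡⟨ cong (F (3 ℕ.+ n) * sgn (suc n) *_) (hankelDet-odd m) ⟩
    F (3 ℕ.+ n) * sgn (suc n) * (sgn (suc n C 2) * F (1 ℕ.+ n))
      ≡⟨ regroup (F (3 ℕ.+ n)) (sgn (suc n)) (sgn (suc n C 2)) (F (1 ℕ.+ n)) ⟩
    F (1 ℕ.+ n) * (sgn (suc n) * sgn (suc n C 2) * F (3 ℕ.+ n))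
      ≡⟨ cong (λ x → F (1 ℕ.+ n) * (x * F (3 ℕ.+ n))) (sgn-C2 (suc n)) ⟨
    F (1 ℕ.+ n) * (sgn ((2 ℕ.+ n) C 2) * F (3 ℕ.+ n)) ∎)
    where
    n = suc (double m)
    regroup : ∀ g x y f → g * x * (y * f) ≡ f * (x * y * g)
    regroup = solve-∀

  hankelDet-odd m = begin
    hankelDet (suc n)                                  ≡⟨ recurrence-even m ⟩
    sgn (suc n) * hankelDet n                          ≡⟨ cong (sgn (suc n) *_) (hankelDet-even m) ⟩
    sgn (suc n) * (sgn (suc n C 2) * F (2 ℕ.+ n))      ≡⟨ ℤ.*-assoc (sgn (suc n)) _ _ ⟨
    sgn (suc n) * sgn (suc n C 2) * F (2 ℕ.+ n)        ≡⟨ cong (_* F (2 ℕ.+ n)) (sgn-C2 (suc n)) ⟨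
    sgn ((2 ℕ.+ n) C 2) * F (2 ℕ.+ n)                    ∎
    where n = double m

  hankelDet≡ : ∀ n → hankelDet n ≡ sgn (suc n C 2) * F (2 ℕ.* ⌊ 2 ℕ.+ n /2⌋)
  hankelDet≡ n with parity n
  ... | even m = trans (hankelDet-even m) (cong (λ k → sgn (suc (double m) C 2) * F k) (begin
    double (suc m)                         ≡⟨ double≡2* (suc m) ⟩
    2 ℕ.* suc m                            ≡⟨ cong (2 ℕ.*_) (⌊double/2⌋ (suc m)) ⟨
    2 ℕ.* ⌊ double (suc m) /2⌋             ∎))
  ... | odd m  = trans (hankelDet-odd m) (cong (λ k → sgn ((2 ℕ.+ double m) C 2) * F k) (begin
    double (suc m)                         ≡⟨ double≡2* (suc m) ⟩
    2 ℕ.* suc m                            ≡⟨ cong (2 ℕ.*_) (⌈double/2⌉ (suc m)) ⟨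
    2 ℕ.* ⌈ double (suc m) /2⌉             ∎))

theorem2p1 : ∀ (n : ℕ) →
    (det (λ (i j : Fin n) → c (toℕ i ℕ.+ toℕ j))
    ≡ -1ℤ ^ (n C 2) * + fib (n ℕ.+ 1))
    × (det (λ (i j : Fin n) → c (toℕ i ℕ.+ toℕ j ℕ.+ 1))
    ≡ -1ℤ ^ ((n ℕ.+ 1) C 2) * + fib (2 ℕ.* ⌊ n ℕ.+ 2 /2⌋))
theorem2p1 n rewrite ℕ.+-comm n 1 | ℕ.+-comm n 2 =
  -- `det≡hankelDet` puts the column index first, so `i + j` is commuted.
  trans (First.det≡hankelDet {n} _ λ i j → trans (c≡e₀ (toℕ i ℕ.+ toℕ j)) (cong (e 0) (ℕ.+-comm (toℕ i) (toℕ j))))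
        (First.hankelDet≡ n) ,
  trans (Second.det≡hankelDet {n} _ λ i j → trans (c≡e₀ (toℕ i ℕ.+ toℕ j ℕ.+ 1))
          (cong (e 0) (trans (ℕ.+-comm _ 1) (cong suc (ℕ.+-comm (toℕ i) (toℕ j))))))
        (Second.hankelDet≡ n)
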